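{- Let $n\ge2$ and $3\le k\le n+1$ be integers, and let $c_1,c_2,\dots,c_l\in\{1,\dots,k\}$ be distinct integers, where $l\ge 3$. For any $\mathrm{OA}(k,n)$ we have, in $\mathbb{Z}_2$, \[ \tau^{c_1}_{c_lc_2}+\tau^{c_2}_{c_1c_3}+\cdots+\tau^{c_i}_{c_{i-1}c_{i+1}}+\cdots+\tau^{c_l}_{c_{l-1}c_1}=l\binom{n}{2}. \]
   Context: An orthogonal array $\mathrm{OA}(k,n)$ on an alphabet $\Lambda$ with $|\Lambda|=n$ is an $n^2\times k$ matrix $A=(a_{r\ell})$ with entries in $\Lambda$ such that in every pair of distinct columns each ordered pair in $\Lambda^2$ occurs in exactly one row. For distinct columns $c,i,j\in\{1,\dots,k\}$ and $s\in\Lambda$, let $\rho_s(c,i,j)$ be the permutation of $\Lambda$ mapping $a_{ri}\mapsto a_{rj}$ for all rows $r$ with $a_{rc}=s$. With $\pi(\gamma)\in\mathbb{Z}_2$ denoting the parity of a permutation $\gamma$ ($0$ for even, $1$ for odd), define $\tau^c_{ij}=\tau^c_{ij}(A)=\sum_{s\in\Lambda}\pi(\rho_s(c,i,j))\in\mathbb{Z}_2$. -}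

module Defs where

open import Data.Bool.Base using (if_then_else_; _∧_)
open import Data.Fin.Base using (Fin; zero; suc; toℕ; fromℕ; inject₁)
open import Data.Fin.Permutation using (Permutation′; _⟨$⟩ʳ_)
open import Data.Fin.Properties using (_<?_; toℕ-inject₁)
open import Data.Fin.Relation.Unary.Top using (view; ‵fromℕ; ‵inject₁)
open import Data.Nat.Base using (ℕ; _^_; _≤_; s≤s; parity)
import Data.Nat.Properties as ℕₚ
open import Data.Parity.Base using (Parity)
import Data.Parity.Properties as ℙₚ
open import Data.Product using (∃!; _×_; _,_; proj₁; proj₂)
open import Data.Vec.Functional using (Vector)
open import Function.Base using (_∘_)
open import Function.Bundles using (_↔_; mk↔ₛ′; Inverse)
open import Function.Properties.Inverse using (↔-sym; ↔-trans)
open import Level using (Level)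
open import Relation.Binary.PropositionalEquality
  using (_≡_; _≢_; refl; sym; trans; cong)
open import Relation.Nullary.Decidable using (⌊_⌋)

-- `Parity`, with its addition, plays the role of ℤ₂.
open import Algebra.Properties.CommutativeMonoid.Sum ℙₚ.+-0-commutativeMonoid public
  using () renaming (sum to ∑ℙ)

open import Algebra.Properties.CommutativeMonoid.Sum ℕₚ.+-0-commutativeMonoid public
  using () renaming (sum to ∑ℕ)

private
  variable
    a : Level
    k l n : ℕ
    Λ : Set a

record OA (k n : ℕ) (Λ : Set a) : Set a where
  field
    alphabet   : Λ ↔ Fin n
    matrix     : Vector (Vector Λ k) (n ^ 2)
    orthogonal : ∀ {i j} → i ≢ j → ∀ x y →
                 ∃! _≡_ λ r → matrix r i ≡ x × matrix r j ≡ y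

inversions : Permutation′ n → ℕ
inversions σ = ∑ℕ λ x → ∑ℕ λ y →
  if ⌊ x <? y ⌋ ∧ ⌊ (σ ⟨$⟩ʳ y) <? (σ ⟨$⟩ʳ x) ⌋ then 1 else 0

-- The parity of a permutation of Λ is that of its transport to Fin n; it does
-- not depend on the enumeration used, since conjugation preserves parity.
π : Λ ↔ Fin n → Λ ↔ Λ → Parity
π enum γ = parity (inversions (↔-trans (↔-sym enum) (↔-trans γ enum)))

module _ (A : OA k n Λ) where
  open OA A

  module _ {c i j : Fin k} (c≢i : c ≢ i) (c≢j : c ≢ j) (s : Λ) where

    move : Λ → Λ
    move x = matrix (proj₁ (orthogonal c≢i s x)) j

    move-unique : ∀ {r x} → matrix r c ≡ s → matrix r i ≡ x → move x ≡ matrix r j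
    move-unique {x = x} p q =
      cong (λ r → matrix r j) (proj₂ (proj₂ (orthogonal c≢i s x)) (p , q))

  move-inverse : ∀ {c i j} (c≢i : c ≢ i) (c≢j : c ≢ j) s x →
                 move c≢j c≢i s (move c≢i c≢j s x) ≡ x
  move-inverse c≢i c≢j s x =
    let _ , (rc≡s , ri≡x) , _ = orthogonal c≢i s x
    in trans (move-unique c≢j c≢i s rc≡s refl) ri≡x

  -- x is sent to the entry in column j of the unique row with s in column c
  -- and x in column i.  The case i ≡ j, where ρ is the identity, need not be
  -- excluded.
  ρ : ∀ s c i j → c ≢ i → c ≢ j → Λ ↔ Λ
  ρ s c i j c≢i c≢j = mk↔ₛ′ (move c≢i c≢j s) (move c≢j c≢i s)
    (move-inverse c≢j c≢i s) (move-inverse c≢i c≢j s)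

  τ : ∀ c i j → c ≢ i → c ≢ j → Parity
  τ c i j c≢i c≢j =
    ∑ℙ λ t → π alphabet (ρ (Inverse.from alphabet t) c i j c≢i c≢j)

-- Predecessor and successor in the cyclic order on Fin l.
prev : Fin l → Fin l
prev zero    = fromℕ _
prev (suc i) = inject₁ i

next : Fin l → Fin l
next i with view i
... | ‵fromℕ     = zero
... | ‵inject₁ j = suc j

private
  inject₁≢suc : (i : Fin n) → inject₁ i ≢ suc i
  inject₁≢suc i eq =
    ℕₚ.1+n≢n (sym (trans (sym (toℕ-inject₁ i)) (cong toℕ eq)))

prev≢ : 3 ≤ l → (i : Fin l) → i ≢ prev i
prev≢ (s≤s (s≤s _)) zero    = λ ()
prev≢ (s≤s _)       (suc i) = inject₁≢suc i ∘ sym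

next≢ : 3 ≤ l → (i : Fin l) → i ≢ next i
next≢ (s≤s (s≤s _)) i with view i
... | ‵fromℕ     = λ ()
... | ‵inject₁ j = inject₁≢suc j

{-# OPTIONS --safe #-}

-- Write [P] ∈ ℤ₂ for the indicator of P.  An inversion of ρ_s(c,i,j) is a pair
-- of rows agreeing in column c whose entries in the columns i and j are ordered
-- oppositely, that is, on which [i increases] + [j increases] = 1.  Orienting
-- the pairs by a fixed order of the rows splits τ^c_ij as u(c,i) + u(c,j), where
-- u(c,i) counts the pairs r < r′ which agree in c and increase in i.  Regrouped by
-- edges of the cycle, the sum becomes that of u(c,d) + u(d,c) over consecutive
-- columns.  With D(c) the number of pairs r < r′ increasing in c,
-- u(c,d) + u(d,c) + D(c) + D(d) is the number of pairs of rows ordered oppositely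
-- by c and d; by orthogonality this is (n C 2)², and each D(c) occurs twice.

module Submission where

open import Defs
import Algebra.Properties.Semiring.Sum
open import Data.Bool.Base using (Bool; true; false; if_then_else_; _∧_)
open import Data.Fin.Base using (Fin; zero; suc; fromℕ; inject₁; punchIn)
open import Data.Fin.Permutation using (Permutation′; _⟨$⟩ʳ_)
open import Data.Fin.Properties using (_<?_; _≟_; <-cmp; punchInᵢ≢i)
open import Data.Fin.Relation.Unary.Top using (view-fromℕ; view-inject₁)
open import Data.Nat.Base as ℕ using (ℕ; zero; suc; _*_; _^_; _≤_; parity)
import Data.Nat.Properties as ℕₚ
open import Data.Nat.Combinatorics using (_C_; nC1≡n; nCk+nC[k+1]≡[n+1]C[k+1])
-- The library declares infixl 7 for both operations of Parity.
open import Data.Parity.Base using (Parity; 0ℙ; 1ℙ)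
  renaming (_+_ to infixl 6 _⊕_; _*_ to infixl 7 _⊗_)
import Data.Parity.Properties as ℙₚ
open import Data.Product using (_,_; proj₁; proj₂)
open import Function.Base using (_∘_)
open import Function.Bundles using (Inverse)
open import Function.Definitions using (Injective)
open import Function.Properties.Inverse using (↔-sym; ↔-trans)
open import Level using (Level)
open import Relation.Binary.Definitions using (tri<; tri≈; tri>)
open import Relation.Binary.PropositionalEquality
open import Relation.Nullary.Decidable using (⌊_⌋; isYes≗does; yes; no)
open import Relation.Nullary.Negation using (contradiction)

private
  module ∑ = Algebra.Properties.Semiring.Sum ℙₚ.+-*-semiring

  variable
    a : Level
    k l m n : ℕ
    Λ : Set a

open ≡-Reasoning

-- Single and double sums in ℤ₂.

∑² : (Fin m → Fin n → Parity) → Parity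
∑² f = ∑ℙ λ i → ∑ℙ (f i)

∑-cong : {f g : Fin n → Parity} → (∀ i → f i ≡ g i) → ∑ℙ f ≡ ∑ℙ g
∑-cong = ∑.sum-cong-≗

∑²-cong : {f g : Fin m → Fin n → Parity} →
          (∀ i j → f i j ≡ g i j) → ∑² f ≡ ∑² g
∑²-cong eq = ∑-cong λ i → ∑-cong (eq i)

∑²-distrib-+ : (f g : Fin m → Fin n → Parity) →
               ∑² (λ i j → f i j ⊕ g i j) ≡ ∑² f ⊕ ∑² g
∑²-distrib-+ f g = trans (∑-cong λ i → ∑.∑-distrib-+ (f i) (g i))
                         (∑.∑-distrib-+ (∑ℙ ∘ f) (∑ℙ ∘ g))

∑-zero : {f : Fin n → Parity} → (∀ i → f i ≡ 0ℙ) → ∑ℙ f ≡ 0ℙ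
∑-zero {n} eq = trans (∑-cong eq) (∑.sum-replicate-zero n)

∑-select : {f : Fin n → Parity} (i : Fin n) → (∀ j → j ≢ i → f j ≡ 0ℙ) → ∑ℙ f ≡ f i
∑-select {suc n} {f} i eq = begin
  ∑ℙ f                       ≡⟨ ∑.sum-remove {i = i} f ⟩
  f i ⊕ ∑ℙ (f ∘ punchIn i)   ≡⟨ cong (f i ⊕_) (∑-zero λ j → eq _ (punchInᵢ≢i i j)) ⟩
  f i ⊕ 0ℙ                   ≡⟨ ℙₚ.+-identityʳ _ ⟩
  f i                        ∎

∑-const : ∀ n m → ∑ℙ {n} (λ _ → parity m) ≡ parity (n * m)
∑-const zero    m = refl
∑-const (suc n) m = trans (cong (parity m ⊕_) (∑-const n m)) (sym (ℙₚ.+-homo-+ m (n * m)))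

-- The two factors share no variable, so the sum separates although the summation order interleaves
-- them.
∑²-* : (f : Fin m → Fin m → Parity) (g : Fin n → Fin n → Parity) →
       ∑² (λ x y → ∑² λ x′ y′ → f x x′ ⊗ g y y′) ≡ ∑² f ⊗ ∑² g
∑²-* f g = begin
  ∑² (λ x y → ∑² λ x′ y′ → f x x′ ⊗ g y y′)
    ≡⟨ ∑²-cong (λ x y → ∑-cong λ x′ → ∑.*-distribˡ-sum (f x x′) (g y)) ⟨
  ∑² (λ x y → ∑ℙ λ x′ → f x x′ ⊗ ∑ℙ (g y))
    ≡⟨ ∑²-cong (λ x y → ∑.*-distribʳ-sum (∑ℙ (g y)) (f x)) ⟨
  ∑² (λ x y → ∑ℙ (f x) ⊗ ∑ℙ (g y))
    ≡⟨ ∑-cong (λ x → ∑.*-distribˡ-sum (∑ℙ (f x)) (∑ℙ ∘ g)) ⟨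
  ∑ℙ (λ x → ∑ℙ (f x) ⊗ ∑² g)
    ≡⟨ ∑.*-distribʳ-sum (∑² g) (∑ℙ ∘ f) ⟨
  ∑² f ⊗ ∑² g ∎

parity-∑ : (f : Fin n → ℕ) → parity (∑ℕ f) ≡ ∑ℙ (parity ∘ f)
parity-∑ {zero}  f = refl
parity-∑ {suc n} f = trans (ℙₚ.+-homo-+ (f zero) _) (cong (parity (f zero) ⊕_) (parity-∑ (f ∘ suc)))

-- Order indicators, increasing pairs and inversions.

infix 8 _≺_ _≐_

⟦_⟧ : Bool → Parity
⟦ b ⟧ = if b then 1ℙ else 0ℙ

_≺_ _≐_ : Fin n → Fin n → Parity
i ≺ j = ⟦ ⌊ i <? j ⌋ ⟧
i ≐ j = ⟦ ⌊ i ≟ j ⌋ ⟧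

-- The possible joint values of i ≺ j, j ≺ i, i ≐ j and j ≐ i.
data Comparison {A : Set} (x y : A) : (lt gt eq eq′ : Parity) → Set where
  less    : x ≢ y → Comparison x y 1ℙ 0ℙ 0ℙ 0ℙ
  equal   : x ≡ y → Comparison x y 0ℙ 0ℙ 1ℙ 1ℙ
  greater : x ≢ y → Comparison x y 0ℙ 1ℙ 0ℙ 0ℙ

-- Abstracting the four decisions together with the trichotomy turns the indices into constants; all
-- but three combinations are contradictory.
compare : (i j : Fin n) → Comparison i j (i ≺ j) (j ≺ i) (i ≐ j) (j ≐ i)
compare i j with <-cmp i j | i <? j | j <? i | i ≟ j | j ≟ i
... | tri< _ ¬p _  | yes _ | no _  | no _  | no _  = less ¬p
... | tri≈ _ p _   | no _  | no _  | yes _ | yes _ = equal p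
... | tri> _ ¬p _  | no _  | yes _ | no _  | no _  = greater ¬p
... | tri< p _ _   | no ¬p | _     | _     | _     = contradiction p ¬p
... | tri< _ _ ¬p  | _     | yes p | _     | _     = contradiction p ¬p
... | tri< _ ¬p _  | _     | _     | yes p | _     = contradiction p ¬p
... | tri< _ ¬p _  | _     | _     | _     | yes p = contradiction (sym p) ¬p
... | tri≈ ¬p _ _  | yes p | _     | _     | _     = contradiction p ¬p
... | tri≈ _ _ ¬p  | _     | yes p | _     | _     = contradiction p ¬p
... | tri≈ _ p _   | _     | _     | no ¬p | _     = contradiction p ¬p
... | tri≈ _ p _   | _     | _     | _     | no ¬p = contradiction (sym p) ¬p
... | tri> ¬p _ _  | yes p | _     | _     | _     = contradiction p ¬p
... | tri> _ _ p   | _     | no ¬p | _     | _     = contradiction p ¬p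
... | tri> _ ¬p _  | _     | _     | yes p | _     = contradiction p ¬p
... | tri> _ ¬p _  | _     | _     | _     | yes p = contradiction (sym p) ¬p

≐-refl : (i : Fin n) → i ≐ i ≡ 1ℙ
≐-refl i with i ≟ i
... | yes _  = refl
... | no i≢i = contradiction refl i≢i

≢⇒≐≡0 : {i j : Fin n} → i ≢ j → i ≐ j ≡ 0ℙ
≢⇒≐≡0 {i = i} {j} i≢j with i ≟ j
... | yes i≡j = contradiction i≡j i≢j
... | no _    = refl

≺-irrefl : (i : Fin n) → i ≺ i ≡ 0ℙ
≺-irrefl i with i ≺ i | i ≐ i | compare i i
... | _ | _ | equal _ = refl

-- The two decisions share their `does` by computation but carry different proofs, hence the passage
-- through `isYes≗does`.
suc-≺-suc : (i j : Fin n) → suc i ≺ suc j ≡ i ≺ j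
suc-≺-suc i j = cong ⟦_⟧ (trans (isYes≗does (suc i <? suc j)) (sym (isYes≗does (i <? j))))

-- Induction by Pascal's rule: `zero` lies below the n successors, and the pairs of successors form
-- the same sum for n.
∑²-≺ : ∀ n → ∑² (_≺_ {n}) ≡ parity (n C 2)
∑²-≺ zero    = refl
∑²-≺ (suc n) = begin
  ∑ℙ {n} (λ _ → 1ℙ) ⊕ ∑² (λ (i j : Fin n) → suc i ≺ suc j)
    ≡⟨ cong₂ _⊕_ (∑-const n 1) (∑²-cong (suc-≺-suc {n})) ⟩
  parity (n * 1) ⊕ ∑² (_≺_ {n})
    ≡⟨ cong₂ (λ m p → parity m ⊕ p) (trans (ℕₚ.*-identityʳ n) (sym (nC1≡n n))) (∑²-≺ n) ⟩
  parity (n C 1) ⊕ parity (n C 2)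
    ≡⟨ ℙₚ.+-homo-+ (n C 1) (n C 2) ⟨
  parity (n C 1 ℕ.+ n C 2)
    ≡⟨ cong parity (nCk+nC[k+1]≡[n+1]C[k+1] n 1) ⟩
  parity (suc n C 2) ∎

-- Off the diagonal exactly one of r < r′ and r′ < r holds; exchanging the two sums renames the
-- pairs of the second kind.
∑²-orient : (F : Fin n → Fin n → Parity) → (∀ r → F r r ≡ 0ℙ) →
            ∑² F ≡ ∑² λ r r′ → r ≺ r′ ⊗ (F r r′ ⊕ F r′ r)
∑²-orient F F-diag = begin
  ∑² F
    ≡⟨ ∑²-cong (λ r r′ → split (compare r r′) λ { refl → F-diag r }) ⟩
  ∑² (λ r r′ → r ≺ r′ ⊗ F r r′ ⊕ r′ ≺ r ⊗ F r r′)
    ≡⟨ ∑²-distrib-+ (λ r r′ → r ≺ r′ ⊗ F r r′) (λ r r′ → r′ ≺ r ⊗ F r r′) ⟩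
  ∑² (λ r r′ → r ≺ r′ ⊗ F r r′) ⊕ ∑² (λ r r′ → r′ ≺ r ⊗ F r r′)
    ≡⟨ cong (∑² (λ r r′ → r ≺ r′ ⊗ F r r′) ⊕_) (∑.∑-comm λ r r′ → r′ ≺ r ⊗ F r r′) ⟩
  ∑² (λ r r′ → r ≺ r′ ⊗ F r r′) ⊕ ∑² (λ r r′ → r ≺ r′ ⊗ F r′ r)
    ≡⟨ ∑²-distrib-+ (λ r r′ → r ≺ r′ ⊗ F r r′) (λ r r′ → r ≺ r′ ⊗ F r′ r) ⟨
  ∑² (λ r r′ → r ≺ r′ ⊗ F r r′ ⊕ r ≺ r′ ⊗ F r′ r)
    ≡⟨ ∑²-cong (λ r r′ → ℙₚ.*-distribˡ-+ (r ≺ r′) (F r r′) (F r′ r)) ⟨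
  ∑² (λ r r′ → r ≺ r′ ⊗ (F r r′ ⊕ F r′ r)) ∎
  where
  split : ∀ {r r′ : Fin _} {lt gt eq eq′ x} → Comparison r r′ lt gt eq eq′ →
          (r ≡ r′ → x ≡ 0ℙ) → x ≡ lt ⊗ x ⊕ gt ⊗ x
  split {x = x} (less _) _ = sym (ℙₚ.+-identityʳ x)
  split (equal p)   h      = h p
  split (greater _) _      = refl

parity-inversions : (σ : Permutation′ n) →
  parity (inversions σ) ≡ ∑² λ x y → x ≺ y ⊗ (σ ⟨$⟩ʳ y) ≺ (σ ⟨$⟩ʳ x)
parity-inversions {n} σ =
  trans (parity-∑ {n} _) (∑-cong λ x → trans (parity-∑ {n} _) (∑-cong λ y →
    ∧-* ⌊ x <? y ⌋ ⌊ (σ ⟨$⟩ʳ y) <? (σ ⟨$⟩ʳ x) ⌋))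
  where
  ∧-* : ∀ b b′ → parity (if b ∧ b′ then 1 else 0) ≡ ⟦ b ⟧ ⊗ ⟦ b′ ⟧
  ∧-* true  true  = refl
  ∧-* true  false = refl
  ∧-* false _     = refl

-- Reindexing around the cycle.

next-fromℕ : ∀ n → next (fromℕ n) ≡ zero
next-fromℕ n rewrite view-fromℕ n = refl

next-inject₁ : (i : Fin n) → next (inject₁ i) ≡ suc i
next-inject₁ i rewrite view-inject₁ i = refl

-- Both sides run over the edges of the cycle, indexed by head or by tail. The closing edge is the
-- first term on the left and the last on the right.
∑-prev-next : (G : Fin l → Fin l → Parity) →
              ∑ℙ (λ i → G i (prev i)) ≡ ∑ℙ λ i → G (next i) i
∑-prev-next {zero}  G = refl
∑-prev-next {suc l} G = begin
  G zero (fromℕ l) ⊕ ∑ℙ (λ i → G (suc i) (inject₁ i))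
    ≡⟨ ℙₚ.+-comm (G zero (fromℕ l)) _ ⟩
  ∑ℙ (λ i → G (suc i) (inject₁ i)) ⊕ G zero (fromℕ l)
    ≡⟨ cong₂ _⊕_ (∑-cong λ i → cong (λ j → G j (inject₁ i)) (next-inject₁ i))
                   (cong (λ j → G j (fromℕ l)) (next-fromℕ l)) ⟨
  ∑ℙ (λ i → G (next (inject₁ i)) (inject₁ i)) ⊕ G (next (fromℕ l)) (fromℕ l)
    ≡⟨ ∑.sum-init-last (λ i → G (next i) i) ⟨
  ∑ℙ (λ i → G (next i) i) ∎

-- Two distinct columns as coordinates on the rows.

module _ (A : OA k n Λ) where
  open OA A
  open Inverse alphabet using (to; from; strictlyInverseˡ; strictlyInverseʳ)

  entry : Fin (n ^ 2) → Fin k → Fin n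
  entry r i = to (matrix r i)

  module _ {i j : Fin k} (i≢j : i ≢ j) where

    row : Fin n → Fin n → Fin (n ^ 2)
    row x y = proj₁ (orthogonal i≢j (from x) (from y))

    entry-rowˡ : ∀ x y → entry (row x y) i ≡ x
    entry-rowˡ x y = let _ , (p , _) , _ = orthogonal i≢j (from x) (from y)
                     in trans (cong to p) (strictlyInverseˡ x)

    entry-rowʳ : ∀ x y → entry (row x y) j ≡ y
    entry-rowʳ x y = let _ , (_ , q) , _ = orthogonal i≢j (from x) (from y)
                     in trans (cong to q) (strictlyInverseˡ y)

    row-entry : ∀ r → row (entry r i) (entry r j) ≡ r
    row-entry r = let _ , _ , unique = orthogonal i≢j _ _
                  in unique (sym (strictlyInverseʳ _) , sym (strictlyInverseʳ _))

    rows-agree : ∀ {r r′} → entry r i ≡ entry r′ i → entry r j ≡ entry r′ j → r ≡ r′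
    rows-agree {r} {r′} p q = trans (sym (row-entry r)) (trans (cong₂ row p q) (row-entry r′))

    -- Inserting the indicator `row x y ≐ r` and exchanging sums works because each r has exactly
    -- one pair of coordinates.
    ∑-rows : (f : Fin (n ^ 2) → Parity) → ∑ℙ f ≡ ∑² λ x y → f (row x y)
    ∑-rows f = begin
      ∑ℙ f
        ≡⟨ ∑-cong by-row ⟨
      ∑ℙ (λ r → ∑² λ x y → g x y r)
        ≡⟨ ∑.∑-comm (λ r x → ∑ℙ λ y → g x y r) ⟩
      ∑ℙ (λ x → ∑ℙ λ r → ∑ℙ λ y → g x y r)
        ≡⟨ ∑-cong (λ x → ∑.∑-comm λ r y → g x y r) ⟩
      ∑² (λ x y → ∑ℙ (g x y))
        ≡⟨ ∑²-cong by-entries ⟩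
      ∑² (λ x y → f (row x y)) ∎
      where
      g : Fin n → Fin n → Fin (n ^ 2) → Parity
      g x y r = row x y ≐ r ⊗ f r

      g-≢ : ∀ {x y r} → row x y ≢ r → g x y r ≡ 0ℙ
      g-≢ {r = r} ne = cong (_⊗ f r) (≢⇒≐≡0 ne)

      g-≡ : ∀ {x y r} → row x y ≡ r → g x y r ≡ f r
      g-≡ {r = r} refl = cong (_⊗ f r) (≐-refl r)

      by-row : ∀ r → ∑² (λ x y → g x y r) ≡ f r
      by-row r = begin
        ∑² (λ x y → g x y r)
          ≡⟨ ∑-select (entry r i) (λ x ne → ∑-zero λ y →
               g-≢ λ eq → ne (trans (sym (entry-rowˡ x y)) (cong (λ r → entry r i) eq))) ⟩
        ∑ℙ (λ y → g (entry r i) y r)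
          ≡⟨ ∑-select (entry r j) (λ y ne →
               g-≢ λ eq → ne (trans (sym (entry-rowʳ (entry r i) y)) (cong (λ r → entry r j) eq))) ⟩
        g (entry r i) (entry r j) r
          ≡⟨ g-≡ (row-entry r) ⟩
        f r ∎

      by-entries : ∀ x y → ∑ℙ (g x y) ≡ f (row x y)
      by-entries x y = trans (∑-select (row x y) λ r ne → g-≢ (ne ∘ sym)) (g-≡ refl)

    -- `F` takes the entries as separate arguments so that they become the summation variables
    -- themselves, not entries of `row x y`.
    ∑²-rows : (F : Fin n → Fin n → Fin (n ^ 2) → Fin n → Fin n → Fin (n ^ 2) → Parity) →
      ∑² (λ r r′ → F (entry r i) (entry r j) r (entry r′ i) (entry r′ j) r′)
        ≡ ∑² λ x y → ∑² λ x′ y′ → F x y (row x y) x′ y′ (row x′ y′)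
    ∑²-rows F = trans (∑-rows _) (∑²-cong λ x y → trans (∑-rows _) (∑²-cong λ x′ y′ →
      trans (cong₂ (λ p q → F p q (row x y) (entry (row x′ y′) i) (entry (row x′ y′) j) (row x′ y′))
                   (entry-rowˡ x y) (entry-rowʳ x y))
            (cong₂ (λ p q → F x y (row x y) p q (row x′ y′))
                   (entry-rowˡ x′ y′) (entry-rowʳ x′ y′))))

  -- Splitting τ into contributions of ordered pairs of columns.

  τ-rows : ∀ c i j (c≢i : c ≢ i) (c≢j : c ≢ j) →
    τ A c i j c≢i c≢j ≡ ∑² λ r r′ →
      entry r c ≐ entry r′ c ⊗ (entry r i ≺ entry r′ i ⊗ entry r′ j ≺ entry r j)
  τ-rows c i j c≢i c≢j = begin
    τ A c i j c≢i c≢j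
      -- The transported permutation sends x, by definition, to the entry in column j of `ro t x`.
      ≡⟨ ∑-cong (λ t → parity-inversions
           (↔-trans (↔-sym alphabet) (↔-trans (ρ A (from t) c i j c≢i c≢j) alphabet))) ⟩
    ∑² (λ t x → ∑ℙ (H t x t))
      -- The indicator `t ≐ t′` lets the second row have its own entry in column c, which gives a
      -- sum over two independent rows.
      ≡⟨ ∑²-cong same-entry ⟨
    ∑² (λ t x → ∑² λ t′ y → t ≐ t′ ⊗ H t x t′ y)
      ≡⟨ ∑²-rows c≢i (λ t x r t′ y r′ → t ≐ t′ ⊗ (x ≺ y ⊗ entry r′ j ≺ entry r j)) ⟨
    ∑² (λ r r′ → entry r c ≐ entry r′ c ⊗ (entry r i ≺ entry r′ i ⊗ entry r′ j ≺ entry r j)) ∎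
    where
    ro = row c≢i

    H : Fin n → Fin n → Fin n → Fin n → Parity
    H t x t′ y = x ≺ y ⊗ entry (ro t′ y) j ≺ entry (ro t x) j

    same-entry : ∀ t x →
      ∑² (λ t′ y → t ≐ t′ ⊗ H t x t′ y) ≡ ∑ℙ (H t x t)
    same-entry t x = trans
      (∑-select t λ t′ ne → ∑-zero λ y → cong (_⊗ H t x t′ y) (≢⇒≐≡0 (ne ∘ sym)))
      (∑-cong λ y → cong (_⊗ H t x t y) (≐-refl t))

  u : Fin k → Fin k → Parity
  u c i = ∑² λ r r′ → r ≺ r′ ⊗ (entry r c ≐ entry r′ c ⊗ entry r i ≺ entry r′ i)

  D : Fin k → Parity
  D c = ∑² λ r r′ → r ≺ r′ ⊗ entry r c ≺ entry r′ c

  τ-split : ∀ c i j (c≢i : c ≢ i) (c≢j : c ≢ j) → τ A c i j c≢i c≢j ≡ u c i ⊕ u c j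
  τ-split c i j c≢i c≢j = begin
    τ A c i j c≢i c≢j
      ≡⟨ τ-rows c i j c≢i c≢j ⟩
    ∑² F
      ≡⟨ ∑²-orient F (λ r → trans
           (cong (λ p → entry r c ≐ entry r c ⊗ (p ⊗ _)) (≺-irrefl (entry r i)))
           (ℙₚ.*-zeroʳ _)) ⟩
    ∑² (λ r r′ → r ≺ r′ ⊗ (F r r′ ⊕ F r′ r))
      ≡⟨ ∑²-cong (λ r r′ → pointwise (compare r r′)
           (compare (entry r c) (entry r′ c)) (compare (entry r i) (entry r′ i))
           (compare (entry r j) (entry r′ j)) (rows-agree c≢i) (rows-agree c≢j)) ⟩
    ∑² (λ r r′ → v i r r′ ⊕ v j r r′)
      ≡⟨ ∑²-distrib-+ (v i) (v j) ⟩
    u c i ⊕ u c j ∎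
    where
    F : Fin (n ^ 2) → Fin (n ^ 2) → Parity
    F r r′ = entry r c ≐ entry r′ c ⊗ (entry r i ≺ entry r′ i ⊗ entry r′ j ≺ entry r j)

    v : Fin k → Fin (n ^ 2) → Fin (n ^ 2) → Parity
    v d r r′ = r ≺ r′ ⊗ (entry r c ≐ entry r′ c ⊗ entry r d ≺ entry r′ d)

    -- Distinct rows that agree in c differ in i and in j, so both columns order them strictly; the
    -- orders are opposite exactly when one of the two columns increases.
    pointwise : ∀ {R X : Set} {r r′ : R} {x x′ y y′ z z′ : X}
      {r< r> r= r=′ x< x> x= x=′ y< y> y= y=′ z< z> z= z=′} →
      Comparison r r′ r< r> r= r=′ → Comparison x x′ x< x> x= x=′ →
      Comparison y y′ y< y> y= y=′ → Comparison z z′ z< z> z= z=′ →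
      (x ≡ x′ → y ≡ y′ → r ≡ r′) → (x ≡ x′ → z ≡ z′ → r ≡ r′) →
      r< ⊗ (x= ⊗ (y< ⊗ z>) ⊕ x=′ ⊗ (y> ⊗ z<))
        ≡ r< ⊗ (x= ⊗ y<) ⊕ r< ⊗ (x= ⊗ z<)
    pointwise (equal _)   _ _ _ _ _ = refl
    pointwise (greater _) _ _ _ _ _ = refl
    pointwise (less _) (less _)    _ _ _ _ = refl
    pointwise (less _) (greater _) _ _ _ _ = refl
    pointwise (less r≢r′) (equal p) (equal q) _ h _ = contradiction (h p q) r≢r′
    pointwise (less r≢r′) (equal p) _ (equal q) _ h = contradiction (h p q) r≢r′
    pointwise (less _) (equal _) (less _)    (less _)    _ _ = refl
    pointwise (less _) (equal _) (less _)    (greater _) _ _ = refl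
    pointwise (less _) (equal _) (greater _) (less _)    _ _ = refl
    pointwise (less _) (equal _) (greater _) (greater _) _ _ = refl

  -- The contribution of one edge of the cycle.

  ∑²-opposite : ∀ {c d} → c ≢ d →
    ∑² (λ r r′ → entry r c ≺ entry r′ c ⊗ entry r′ d ≺ entry r d) ≡ parity (n C 2)
  ∑²-opposite {c} {d} c≢d = begin
    ∑² (λ r r′ → entry r c ≺ entry r′ c ⊗ entry r′ d ≺ entry r d)
      ≡⟨ ∑²-rows c≢d (λ x y _ x′ y′ _ → x ≺ x′ ⊗ y′ ≺ y) ⟩
    ∑² {n} {n} (λ x y → ∑² {n} {n} λ x′ y′ → x ≺ x′ ⊗ y′ ≺ y)
      -- In the coordinates c and d the conditions on the two columns are independent.
      ≡⟨ ∑²-* {n} {n} _≺_ (λ y y′ → y′ ≺ y) ⟩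
    ∑² (_≺_ {n}) ⊗ ∑² (λ (y y′ : Fin n) → y′ ≺ y)
      ≡⟨ cong (∑² (_≺_ {n}) ⊗_) (∑.∑-comm {n} {n} λ y y′ → y′ ≺ y) ⟩
    ∑² (_≺_ {n}) ⊗ ∑² (_≺_ {n})
      -- Squaring is the identity on ℤ₂.
      ≡⟨ ℙₚ.*-idem _ ⟩
    ∑² (_≺_ {n})
      ≡⟨ ∑²-≺ n ⟩
    parity (n C 2) ∎

  -- Beyond the constant, an edge contributes only terms attached to its endpoints, and these cancel
  -- around a closed cycle.
  u-sym : ∀ {c d} → c ≢ d → u c d ⊕ u d c ≡ (D c ⊕ D d) ⊕ parity (n C 2)
  u-sym {c} {d} c≢d = begin
    u c d ⊕ u d c
      ≡⟨ ∑²-distrib-+ (v c d) (v d c) ⟨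
    ∑² (λ r r′ → v c d r r′ ⊕ v d c r r′)
      ≡⟨ ∑²-cong (λ r r′ → pointwise (r ≺ r′)
           (compare (entry r c) (entry r′ c)) (compare (entry r d) (entry r′ d))) ⟩
    ∑² (λ r r′ → (w c r r′ ⊕ w d r r′) ⊕ O r r′)
      ≡⟨ ∑²-distrib-+ (λ r r′ → w c r r′ ⊕ w d r r′) O ⟩
    ∑² (λ r r′ → w c r r′ ⊕ w d r r′) ⊕ ∑² O
      -- `∑²-orient` is read backwards, from oriented pairs of rows to all ordered pairs.
      ≡⟨ cong₂ _⊕_ (∑²-distrib-+ (w c) (w d)) (sym (∑²-orient F λ r →
           cong (_⊗ _) (≺-irrefl (entry r c)))) ⟩
    (D c ⊕ D d) ⊕ ∑² F
      ≡⟨ cong ((D c ⊕ D d) ⊕_) (∑²-opposite c≢d) ⟩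
    (D c ⊕ D d) ⊕ parity (n C 2) ∎
    where
    v : Fin k → Fin k → Fin (n ^ 2) → Fin (n ^ 2) → Parity
    v c d r r′ = r ≺ r′ ⊗ (entry r c ≐ entry r′ c ⊗ entry r d ≺ entry r′ d)

    w : Fin k → Fin (n ^ 2) → Fin (n ^ 2) → Parity
    w c r r′ = r ≺ r′ ⊗ entry r c ≺ entry r′ c

    F O : Fin (n ^ 2) → Fin (n ^ 2) → Parity
    F r r′ = entry r c ≺ entry r′ c ⊗ entry r′ d ≺ entry r d
    O r r′ = r ≺ r′ ⊗ (F r r′ ⊕ F r′ r)

    -- If one column ties, the other alone decides both sides. If neither ties, the left side is 0,
    -- and on the right the sum of the two increase indicators equals the indicator of opposite
    -- order.
    pointwise : ∀ {x x′ y y′ : Fin n} r< {x< x> x= x=′ y< y> y= y=′} →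
      Comparison x x′ x< x> x= x=′ → Comparison y y′ y< y> y= y=′ →
      r< ⊗ (x= ⊗ y<) ⊕ r< ⊗ (y= ⊗ x<)
        ≡ (r< ⊗ x< ⊕ r< ⊗ y<) ⊕ r< ⊗ (x< ⊗ y> ⊕ x> ⊗ y<)
    pointwise 0ℙ _           _           = refl
    pointwise 1ℙ (less _)    (less _)    = refl
    pointwise 1ℙ (less _)    (equal _)   = refl
    pointwise 1ℙ (less _)    (greater _) = refl
    pointwise 1ℙ (equal _)   (less _)    = refl
    pointwise 1ℙ (equal _)   (equal _)   = refl
    pointwise 1ℙ (equal _)   (greater _) = refl
    pointwise 1ℙ (greater _) (less _)    = refl
    pointwise 1ℙ (greater _) (equal _)   = refl
    pointwise 1ℙ (greater _) (greater _) = refl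

-- Summation around the cycle.

lemma2p6 : ∀ {a} {Λ : Set a} (n k l : ℕ) → 2 ≤ n → 3 ≤ k → k ≤ suc n →
    (3≤l : 3 ≤ l) (A : OA k n Λ)
    (c : Fin l → Fin k) (c-distinct : Injective _≡_ _≡_ c) →
    ∑ℙ (λ i → τ A (c i) (c (prev i)) (c (next i)) (prev≢ 3≤l i ∘ c-distinct) (next≢ 3≤l i ∘ c-distinct))
    ≡ parity (l * (n C 2))
lemma2p6 n k l _ _ _ 3≤l A c c-distinct = begin
  _ ≡⟨ ∑-cong (λ i → τ-split A (c i) (c (prev i)) (c (next i))
                               (prev≢ 3≤l i ∘ c-distinct) (next≢ 3≤l i ∘ c-distinct)) ⟩
  ∑ℙ (λ i → U (c i) (c (prev i)) ⊕ U (c i) (c (next i)))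
    ≡⟨ ∑.∑-distrib-+ (λ i → U (c i) (c (prev i))) (λ i → U (c i) (c (next i))) ⟩
  ∑ℙ (λ i → U (c i) (c (prev i))) ⊕ ∑ℙ (λ i → U (c i) (c (next i)))
    -- The half of each τ that looks backwards is moved to the preceding index, so that both terms
    -- of an edge meet.
    ≡⟨ cong (_⊕ ∑ℙ λ i → U (c i) (c (next i))) (∑-prev-next λ i j → U (c i) (c j)) ⟩
  ∑ℙ (λ i → U (c (next i)) (c i)) ⊕ ∑ℙ (λ i → U (c i) (c (next i)))
    ≡⟨ ∑.∑-distrib-+ (λ i → U (c (next i)) (c i)) (λ i → U (c i) (c (next i))) ⟨
  ∑ℙ (λ i → U (c (next i)) (c i) ⊕ U (c i) (c (next i)))
    ≡⟨ ∑-cong (λ i → u-sym A (next≢ 3≤l i ∘ sym ∘ c-distinct)) ⟩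
  ∑ℙ (λ i → (E (c (next i)) ⊕ E (c i)) ⊕ parity (n C 2))
    ≡⟨ ∑.∑-distrib-+ (λ i → E (c (next i)) ⊕ E (c i)) (λ _ → parity (n C 2)) ⟩
  ∑ℙ (λ i → E (c (next i)) ⊕ E (c i)) ⊕ ∑ℙ {l} (λ _ → parity (n C 2))
    ≡⟨ cong₂ _⊕_ twice (∑-const l (n C 2)) ⟩
  parity (l * (n C 2)) ∎
  where
  U = u A
  E = D A

  twice : ∑ℙ (λ i → E (c (next i)) ⊕ E (c i)) ≡ 0ℙ
  twice = begin
    ∑ℙ (λ i → E (c (next i)) ⊕ E (c i))
      ≡⟨ ∑.∑-distrib-+ (E ∘ c ∘ next) (E ∘ c) ⟩
    ∑ℙ (E ∘ c ∘ next) ⊕ ∑ℙ (E ∘ c)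
      -- With a `G` that ignores its second argument, the shift says that summing over successors is
      -- summing over all indices.
      ≡⟨ cong (_⊕ ∑ℙ (E ∘ c)) (∑-prev-next λ i _ → E (c i)) ⟨
    ∑ℙ (E ∘ c) ⊕ ∑ℙ (E ∘ c)
      ≡⟨ ℙₚ.p+p≡0ℙ (∑ℙ (E ∘ c)) ⟩
    0ℙ ∎
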